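{- Let $G_1$ be a PMH-graph admitting a vertex $u$ of degree $3$, let $G_2$ be a graph admitting a 3-malleable vertex $v$, and let $G_1(u)*G_2(v)$ be a graph obtained by a star product on $u$ and $v$. If at least one of $G_1$ and $G_2$ is bipartite, then $G_1(u)*G_2(v)$ is PMH.
   Context: Graphs are finite and connected, may have multiple (parallel) edges, and have no loops; the degree of a vertex is the number of edges incident to it. A perfect matching is the edge set of a $1$-regular spanning subgraph, and a Hamiltonian cycle is a connected $2$-regular spanning subgraph. A Hamiltonian cycle $H$ extends a perfect matching $M$ if $M\subseteq E(H)$. A graph admitting a perfect matching is PMH if each of its perfect matchings can be extended to a Hamiltonian cycle. For a vertex $v$, $\partial v$ denotes the set of edges incident to $v$. If $G$ admits a perfect matching and $v$ is a vertex of degree $t\ge 2$, then $v$ is $t$-malleable if for every perfect matching $M$ of $G$ there exist Hamiltonian cycles $H_1,\dots,H_{t-1}$ of $G$, all extending $M$, such that $\partial v - M\subset \bigcup_{i=1}^{t-1}E(H_i)$. (In particular, a graph with a malleable vertex admits a perfect matching.) Star product: let $u\in V(G_1)$, $v\in V(G_2)$ be vertices of degree 3, with incident edges $uu_1,uu_2,uu_3$ and $vv_1,vv_2,vv_3$ respectively. A star product on $u$ and $v$, denoted $G_1(u)*G_2(v)$, is the graph $(G_1-u)\cup(G_2-v)\cup\{u_1v_1,u_2v_2,u_3v_3\}$ (for any choice of the ordering of the neighbours). It is assumed that neither $G_1$ nor $G_2$ is the cubic graph on two vertices (three parallel edges). -}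

module Defs where

open import Data.Bool using (Bool; true; T; if_then_else_)
open import Data.Bool.Properties using (T?)
open import Data.Fin using (Fin)
import Data.Fin.Properties as Fin
import Data.Empty.Irrelevant as Irrelevant
open import Data.Irrelevant using ([_])
open import Data.List using (List; []; _∷_; _++_; map; filter; length; allFin)
open import Data.List.Membership.Propositional using (_∈_)
open import Data.List.Membership.Propositional.Properties
  using (∈-map⁺; ∈-map⁻; ∈-++⁺ˡ; ∈-++⁺ʳ; ∈-allFin)
open import Data.List.Relation.Unary.All using (All; []; _∷_)
open import Data.List.Relation.Unary.AllPairs using ([]; _∷_)
open import Data.List.Relation.Unary.Any using (here; there)
open import Data.List.Relation.Unary.Unique.Propositional using (Unique)
import Data.List.Relation.Unary.Unique.Propositional.Properties as Unique
open import Data.Nat using (ℕ; _∸_; _≥_)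
open import Data.Product using (Σ-syntax; ∃-syntax; _×_; _,_)
open import Data.Refinement using (Refinement-syntax; value; value-injective; _,_)
import Data.Refinement as Refinement
open import Data.Sum using (_⊎_; inj₁; inj₂)
open import Data.Sum.Properties using (inj₁-injective; inj₂-injective; ≡-dec)
open import Function using (_↔_; Inverse)
open import Relation.Binary.Construct.Closure.ReflexiveTransitive as Star using (Star)
open import Relation.Binary.Definitions using (DecidableEquality)
open import Relation.Binary.PropositionalEquality
  using (_≡_; _≢_; refl; sym; trans; cong)
open import Relation.Nullary using (¬_; Dec; yes; no; does; ¬?)
open import Relation.Nullary.Decidable using (_⊎-dec_; _×-dec_)
open import Relation.Unary using (Decidable)

record Finite (A : Set) : Set where
  field
    _≟_      : DecidableEquality A
    elements : List A
    complete : ∀ x → x ∈ elements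
    unique   : Unique elements

open Finite public using (elements)

finite-Fin : ∀ n → Finite (Fin n)
finite-Fin n = record
  { _≟_      = Fin._≟_
  ; elements = allFin n
  ; complete = ∈-allFin
  ; unique   = Unique.allFin⁺ n
  }

finite-⊎ : ∀ {A B} → Finite A → Finite B → Finite (A ⊎ B)
finite-⊎ {A} {B} FA FB = record
  { _≟_      = ≡-dec A._≟_ B._≟_
  ; elements = as ++ bs
  ; complete = λ where
      (inj₁ a) → ∈-++⁺ˡ (∈-map⁺ inj₁ (A.complete a))
      (inj₂ b) → ∈-++⁺ʳ as (∈-map⁺ inj₂ (B.complete b))
  ; unique   = Unique.++⁺ (Unique.map⁺ inj₁-injective A.unique)
                          (Unique.map⁺ inj₂-injective B.unique)
                          disjoint
  }
  where
  module A = Finite FA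
  module B = Finite FB
  as bs : List (A ⊎ B)
  as = map inj₁ A.elements
  bs = map inj₂ B.elements
  disjoint : ∀ {x} → ¬ (x ∈ as × x ∈ bs)
  disjoint (p , q) with ∈-map⁻ inj₁ p | ∈-map⁻ inj₂ q
  ... | _ , _ , refl | _ , _ , ()

module _ {A : Set} {P : A → Set} (P? : Decidable P) where

  restrict : List A → List [ x ∈ A ∣ P x ]
  restrict []       = []
  restrict (x ∷ xs) with P? x
  ... | yes p = (x , [ p ]) ∷ restrict xs
  ... | no  _ = restrict xs

  restrict-∈ : ∀ {xs} (y : [ x ∈ A ∣ P x ]) → value y ∈ xs → y ∈ restrict xs
  restrict-∈ {x ∷ xs} y             (there i)   with P? x
  ... | yes _ = there (restrict-∈ y i)
  ... | no  _ = restrict-∈ y i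
  restrict-∈ {x ∷ xs} (.x , [ p ]) (here refl) with P? x
  ... | yes _  = here refl
  ... | no  ¬p = Irrelevant.⊥-elim (¬p p)

  restrict-≢ : ∀ {x xs} (y : [ x ∈ A ∣ P x ]) → value y ≡ x →
               All (x ≢_) xs → All (y ≢_) (restrict xs)
  restrict-≢ {xs = []}     y eq []         = []
  restrict-≢ {xs = z ∷ zs} y eq (x≢z ∷ ps) with P? z
  ... | yes _ = (λ y≡z → x≢z (trans (sym eq) (cong value y≡z))) ∷ restrict-≢ y eq ps
  ... | no  _ = restrict-≢ y eq ps

  restrict-unique : ∀ {xs} → Unique xs → Unique (restrict xs)
  restrict-unique {[]}     []       = []
  restrict-unique {x ∷ xs} (p ∷ ps) with P? x
  ... | yes q = restrict-≢ (x , [ q ]) refl p ∷ restrict-unique ps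
  ... | no  _ = restrict-unique ps

  finite-Refinement : Finite A → Finite [ x ∈ A ∣ P x ]
  finite-Refinement F = record
    { _≟_      = Refinement._≟_ (Finite._≟_ F)
    ; elements = restrict (elements F)
    ; complete = λ y → restrict-∈ y (Finite.complete F (value y))
    ; unique   = restrict-unique (Finite.unique F)
    }

-- The order of the two ends of an edge carries no meaning: every notion
-- below treats end₁ and end₂ symmetrically.
record Multigraph : Set₁ where
  field
    V E       : Set
    finite-V  : Finite V
    finite-E  : Finite E
    end₁ end₂ : E → V
    loopless  : ∀ e → end₁ e ≢ end₂ e

  infix 4 _≟_
  _≟_ : DecidableEquality V
  _≟_ = Finite._≟_ finite-V

  Incident : V → E → Set
  Incident v e = v ≡ end₁ e ⊎ v ≡ end₂ e

  incident? : ∀ v e → Dec (Incident v e)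
  incident? v e = (v ≟ end₁ e) ⊎-dec (v ≟ end₂ e)

  -- Meaningful only when v is an end of e.
  otherEnd : V → E → V
  otherEnd v e = if does (v ≟ end₁ e) then end₂ e else end₁ e

  otherEnd-≢ : ∀ {v e} → Incident v e → otherEnd v e ≢ v
  otherEnd-≢ {v} {e} inc eq with v ≟ end₁ e
  otherEnd-≢ {e = e} inc         eq | yes v≡₁ = loopless e (sym (trans eq v≡₁))
  otherEnd-≢         (inj₁ v≡₁) eq | no  v≢₁ = v≢₁ v≡₁
  otherEnd-≢ {e = e} (inj₂ v≡₂) eq | no  v≢₁ = loopless e (trans eq v≡₂)

  -- An edge set doubles as the spanning subgraph having exactly these edges.
  EdgeSet : Set
  EdgeSet = E → Bool

  infix 4 _∈ᴱ_ _⊆ᴱ_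
  _∈ᴱ_ : E → EdgeSet → Set
  e ∈ᴱ S = T (S e)

  _⊆ᴱ_ : EdgeSet → EdgeSet → Set
  S ⊆ᴱ S′ = ∀ e → e ∈ᴱ S → e ∈ᴱ S′

  allEdges : EdgeSet
  allEdges _ = true

  degreeIn : EdgeSet → V → ℕ
  degreeIn S v = length (filter (λ e → T? (S e) ×-dec incident? v e) (elements finite-E))

  degree : V → ℕ
  degree = degreeIn allEdges

  Regular : ℕ → EdgeSet → Set
  Regular k S = ∀ v → degreeIn S v ≡ k

  Adjacent : EdgeSet → V → V → Set
  Adjacent S x y =
    ∃[ e ] e ∈ᴱ S × ((x ≡ end₁ e × y ≡ end₂ e) ⊎ (x ≡ end₂ e × y ≡ end₁ e))

  ConnectedBy : EdgeSet → Set
  ConnectedBy S = ∀ x y → Star (Adjacent S) x y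

  Connected : Set
  Connected = ConnectedBy allEdges

  PerfectMatching : EdgeSet → Set
  PerfectMatching = Regular 1

  HamiltonianCycle : EdgeSet → Set
  HamiltonianCycle H = ConnectedBy H × Regular 2 H

  HasPerfectMatching : Set
  HasPerfectMatching = ∃[ M ] PerfectMatching M

  PMH : Set
  PMH = HasPerfectMatching ×
        (∀ M → PerfectMatching M → ∃[ H ] HamiltonianCycle H × M ⊆ᴱ H)

  Malleable : ℕ → V → Set
  Malleable t v =
    t ≥ 2 × degree v ≡ t × HasPerfectMatching ×
    (∀ M → PerfectMatching M →
       Σ[ H ∈ (Fin (t ∸ 1) → EdgeSet) ]
         (∀ i → HamiltonianCycle (H i) × M ⊆ᴱ H i) ×
         (∀ e → Incident v e → ¬ (e ∈ᴱ M) → ∃[ i ] e ∈ᴱ H i))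

  Bipartite : Set
  Bipartite = Σ[ side ∈ (V → Bool) ] ∀ e → side (end₁ e) ≢ side (end₂ e)

  -- Without loops this forces three parallel edges.
  CubicOnTwoVertices : Set
  CubicOnTwoVertices = length (elements finite-V) ≡ 2 × Regular 3 allEdges

  -- For a vertex of degree 3, a labelling of its incident edges (hence, with
  -- multiplicity, of its neighbours) by 0, 1, 2.
  Ordering : V → Set
  Ordering v = Fin 3 ↔ [ e ∈ E ∣ Incident v e ]

  -- PMH does not mention connectedness of the ambient graph, as it implies it.
  PMH⇒Connected : PMH → Connected
  PMH⇒Connected ((M , pm) , extend) x y with extend M pm
  ... | H , (conn , _) , _ = Star.map (λ (e , _ , joins) → e , _ , joins) (conn x y)

-- The part of a graph that survives the deletion of a vertex w, and the
-- neighbours of w listed along an ordering of its incident edges.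
module Delete (G : Multigraph) (w : Multigraph.V G) where
  open Multigraph G

  V⁻ E⁻ : Set
  V⁻ = [ x ∈ V ∣ x ≢ w ]
  E⁻ = [ e ∈ E ∣ ¬ Incident w e ]

  finite-V⁻ : Finite V⁻
  finite-V⁻ = finite-Refinement (λ x → ¬? (x ≟ w)) finite-V

  finite-E⁻ : Finite E⁻
  finite-E⁻ = finite-Refinement (λ e → ¬? (incident? w e)) finite-E

  end₁⁻ end₂⁻ : E⁻ → V⁻
  end₁⁻ (e , [ p ]) = end₁ e , [ (λ eq → p (inj₁ (sym eq))) ]
  end₂⁻ (e , [ p ]) = end₂ e , [ (λ eq → p (inj₂ (sym eq))) ]

  neighbourAlong : [ e ∈ E ∣ Incident w e ] → V⁻
  neighbourAlong (e , [ p ]) = otherEnd w e , [ otherEnd-≢ p ]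

  neighbour : Ordering w → Fin 3 → V⁻
  neighbour α i = neighbourAlong (Inverse.to α i)

module StarProduct (G₁ G₂ : Multigraph) (u : Multigraph.V G₁) (v : Multigraph.V G₂)
                   (α : Multigraph.Ordering G₁ u) (β : Multigraph.Ordering G₂ v) where
  module L = Delete G₁ u
  module R = Delete G₂ v

  V* : Set
  V* = L.V⁻ ⊎ R.V⁻

  -- The edge inj₂ (inj₂ i) joins the i-th neighbour of u to the i-th
  -- neighbour of v.
  E* : Set
  E* = L.E⁻ ⊎ R.E⁻ ⊎ Fin 3

  end₁* end₂* : E* → V*
  end₁* (inj₁ e)        = inj₁ (L.end₁⁻ e)
  end₁* (inj₂ (inj₁ e)) = inj₂ (R.end₁⁻ e)
  end₁* (inj₂ (inj₂ i)) = inj₁ (L.neighbour α i)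
  end₂* (inj₁ e)        = inj₁ (L.end₂⁻ e)
  end₂* (inj₂ (inj₁ e)) = inj₂ (R.end₂⁻ e)
  end₂* (inj₂ (inj₂ i)) = inj₂ (R.neighbour β i)

  loopless* : ∀ e → end₁* e ≢ end₂* e
  loopless* (inj₁ e)        eq = Multigraph.loopless G₁ (value e) (cong value (inj₁-injective eq))
  loopless* (inj₂ (inj₁ e)) eq = Multigraph.loopless G₂ (value e) (cong value (inj₂-injective eq))
  loopless* (inj₂ (inj₂ i)) ()

  starProduct : Multigraph
  starProduct = record
    { V        = V*
    ; E        = E*
    ; finite-V = finite-⊎ L.finite-V⁻ R.finite-V⁻
    ; finite-E = finite-⊎ L.finite-E⁻ (finite-⊎ R.finite-E⁻ (finite-Fin 3))
    ; end₁     = end₁*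
    ; end₂     = end₂*
    ; loopless = loopless*
    }

open StarProduct public using (starProduct)

{-# OPTIONS --safe #-}
module Submission where

-- Since one factor is bipartite and has a perfect matching, every perfect
-- matching M of the star product uses exactly one cut edge, so it contracts to
-- perfect matchings of G₁ and G₂.  Extend the first to a Hamiltonian cycle of
-- G₁; by malleability the second extends to a Hamiltonian cycle of G₂ using the
-- same two labels at the deleted vertex, and the two cycles splice along them.
-- The spliced cycle is connected because a 2-regular connected graph stays
-- connected when a vertex w is removed: all its edges are non-bridges by
-- parity, so every vertex reaches w avoiding one fixed edge at w.

open import Defs
open import Data.Bool using (Bool; true; false; T; not; _∧_; _∨_; if_then_else_)
open import Data.Bool.Properties using (T?; not-injective; ∨-identityʳ)
open import Data.Fin using (Fin)
import Data.Empty.Irrelevant as Irrelevant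
open import Data.Irrelevant using ([_])
open import Data.List using (List; []; _∷_; _++_; map; filter; length)
open import Data.List.Properties using (map-++; map-∘)
open import Data.List.Membership.Propositional using (_∈_)
open import Data.List.Membership.Propositional.Properties using (∈-map⁺)
open import Data.List.Membership.Propositional.Properties.WithK using (unique∧set⇒bag)
open import Data.List.Relation.Binary.BagAndSetEquality using (∼bag⇒↭)
open import Data.List.Relation.Binary.Permutation.Propositional using (_↭_)
import Data.List.Relation.Binary.Permutation.Propositional.Properties as ↭
open import Data.List.Relation.Unary.All using (All; []; _∷_)
open import Data.List.Relation.Unary.AllPairs using ([]; _∷_)
open import Data.List.Relation.Unary.Any using (here; there)
open import Data.List.Relation.Unary.Unique.Propositional using (Unique)
import Data.List.Relation.Unary.Unique.Propositional.Properties as Unique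
open import Data.Nat using (ℕ; zero; suc; _+_; _*_; parity)
open import Data.Nat.ListAction using (sum)
open import Data.Nat.ListAction.Properties using (sum-++; sum-↭)
open import Data.Nat.Properties
  using (+-identityʳ; *-identityʳ; *-zeroʳ; +-comm; +-assoc; *-distribˡ-+; *-identityˡ;
         +-cancelˡ-≡; suc-injective; +-commutativeSemigroup; *-commutativeSemigroup)
open import Algebra.Properties.CommutativeSemigroup +-commutativeSemigroup using (interchange)
open import Algebra.Properties.CommutativeSemigroup *-commutativeSemigroup using (x∙yz≈y∙xz)
open import Data.Parity.Base using (0ℙ; 1ℙ; _⁻¹)
open import Data.Parity.Properties using (suc-homo-⁻¹)
open import Data.Product using (Σ-syntax; ∃-syntax; _×_; _,_; proj₁; proj₂)
open import Data.Refinement using (value; value-injective; _,_)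
open import Data.Sum using (_⊎_; inj₁; inj₂)
open import Function using (_∘_; _↔_; Inverse; mk⇔; const)
open import Relation.Binary.Construct.Closure.ReflexiveTransitive as Star using (Star; ε; _◅_; _◅◅_)
open import Relation.Binary.PropositionalEquality
  using (_≡_; _≢_; refl; sym; trans; cong; cong₂; subst; module ≡-Reasoning)
open import Relation.Nullary using (¬_; Dec; yes; no; does; ¬?; contradiction)
open import Relation.Nullary.Decidable using (dec-true; dec-false; does-⇔; recompute)
open import Relation.Unary using (Decidable)

open ≡-Reasoning

private
  variable
    A B : Set

-- Indicators of booleans and of decidable propositions.

ind : Bool → ℕ
ind b = if b then 1 else 0

ind*≢0 : ∀ {b n} → ind b * n ≢ 0 → T b × n ≢ 0
ind*≢0 {true}  {n} ne = _ , λ n≡0 → ne (trans (+-identityʳ n) n≡0)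
ind*≢0 {false}     ne = contradiction refl ne

ind-does≢0 : ∀ {P : Set} (d : Dec P) → ind (does d) ≢ 0 → P
ind-does≢0 (yes p) _  = p
ind-does≢0 (no _)  ne = contradiction refl ne

ind-dec-true : ∀ {P : Set} (d : Dec P) → P → ind (does d) ≡ 1
ind-dec-true d p = cong ind (dec-true d p)

ind-dec-false : ∀ {P : Set} (d : Dec P) → ¬ P → ind (does d) ≡ 0
ind-dec-false d ¬p = cong ind (dec-false d ¬p)

-- Sums over finite types and their subsets

∑ : Finite A → (A → ℕ) → ℕ
∑ F f = sum (map f (elements F))

sum-cong : ∀ {f g : A → ℕ} → (∀ x → f x ≡ g x) → ∀ xs → sum (map f xs) ≡ sum (map g xs)
sum-cong eq []       = refl
sum-cong eq (x ∷ xs) = cong₂ _+_ (eq x) (sum-cong eq xs)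

sum-+ : ∀ (f g : A → ℕ) xs → sum (map (λ x → f x + g x) xs) ≡ sum (map f xs) + sum (map g xs)
sum-+ f g []       = refl
sum-+ f g (x ∷ xs) = trans (cong (f x + g x +_) (sum-+ f g xs)) (interchange (f x) (g x) _ _)

sum-* : ∀ n (f : A → ℕ) xs → sum (map (λ x → n * f x) xs) ≡ n * sum (map f xs)
sum-* n f []       = sym (*-zeroʳ n)
sum-* n f (x ∷ xs) = trans (cong (n * f x +_) (sum-* n f xs)) (sym (*-distribˡ-+ n (f x) _))

sum-zero : ∀ {f : A → ℕ} {xs} → All (λ x → f x ≡ 0) xs → sum (map f xs) ≡ 0
sum-zero []       = refl
sum-zero (p ∷ ps) = cong₂ _+_ p (sum-zero ps)

sum-swap : ∀ (f : A → B → ℕ) xs ys →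
           sum (map (λ x → sum (map (f x) ys)) xs) ≡ sum (map (λ y → sum (map (λ x → f x y) xs)) ys)
sum-swap f []       ys = sym (sum-zero (zeros ys))
  where
  zeros : ∀ ys → All (λ _ → 0 ≡ 0) ys
  zeros []       = []
  zeros (_ ∷ ys) = refl ∷ zeros ys
sum-swap f (x ∷ xs) ys =
  trans (cong (sum (map (f x) ys) +_) (sum-swap f xs ys)) (sym (sum-+ (f x) _ ys))

sum-supported : ∀ {f : A → ℕ} {a xs} → Unique xs → a ∈ xs → (∀ x → x ≢ a → f x ≡ 0) →
                sum (map f xs) ≡ f a
sum-supported {f = f} {a} (a∉ ∷ _) (here refl) off =
  trans (cong (f a +_) (sum-zero (zeros a∉))) (+-identityʳ (f a))
  where
  zeros : ∀ {ys} → All (a ≢_) ys → All (λ y → f y ≡ 0) ys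
  zeros []       = []
  zeros (p ∷ ps) = off _ (p ∘ sym) ∷ zeros ps
sum-supported (x∉ ∷ u) (there i) off =
  cong₂ _+_ (off _ (All-lookup x∉ i)) (sum-supported u i off)
  where
  All-lookup : ∀ {x a : A} {ys} → All (x ≢_) ys → a ∈ ys → x ≢ a
  All-lookup (p ∷ _)  (here refl) = p
  All-lookup (_ ∷ ps) (there j)   = All-lookup ps j

sum-≢0 : ∀ (f : A → ℕ) xs → sum (map f xs) ≢ 0 → ∃[ x ] f x ≢ 0
sum-≢0 f []       ne = contradiction refl ne
sum-≢0 f (x ∷ xs) ne with f x in eq
... | suc n = x , λ fx≡0 → contradiction (trans (sym eq) fx≡0) λ ()
... | zero  = sum-≢0 f xs ne

sum-filter : ∀ {P : A → Set} (P? : Decidable P) xs →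
             length (filter P? xs) ≡ sum (map (λ x → ind (does (P? x))) xs)
sum-filter P? []       = refl
sum-filter P? (x ∷ xs) with does (P? x)
... | true  = cong suc (sum-filter P? xs)
... | false = sum-filter P? xs

module _ (F : Finite A) where
  open Finite F using (_≟_; complete; unique)

  ∑-cong : ∀ {f g : A → ℕ} → (∀ x → f x ≡ g x) → ∑ F f ≡ ∑ F g
  ∑-cong eq = sum-cong eq (elements F)

  ∑-zero : ∀ {f : A → ℕ} → (∀ x → f x ≡ 0) → ∑ F f ≡ 0
  -- The constant 0 is read as `0 * 0`, so that a factor 0 can be pulled out of the sum.
  ∑-zero eq = trans (∑-cong eq) (sum-* 0 (const 0) (elements F))

  ∑-+ : ∀ (f g : A → ℕ) → ∑ F (λ x → f x + g x) ≡ ∑ F f + ∑ F g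
  ∑-+ f g = sum-+ f g (elements F)

  ∑-supported : ∀ {f : A → ℕ} a → (∀ x → x ≢ a → f x ≡ 0) → ∑ F f ≡ f a
  ∑-supported a = sum-supported unique (complete a)

  -- Needed for `P` being incidence with a deleted vertex: the two summands then range over the
  -- surviving edges and over the codomain of an `Ordering`.
  ∑-refine : ∀ {P : A → Set} (P? : Decidable P) f →
             ∑ F f ≡ ∑ (finite-Refinement (λ x → ¬? (P? x)) F) (f ∘ value) +
                     ∑ (finite-Refinement P? F) (f ∘ value)
  ∑-refine P? f = go (elements F)
    where
    go : ∀ xs → sum (map f xs) ≡ sum (map (f ∘ value) (restrict (λ x → ¬? (P? x)) xs)) +
                                 sum (map (f ∘ value) (restrict P? xs))
    go []       = refl
    go (x ∷ xs) with P? x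
    ... | yes _ = begin
      f x + sum (map f xs)  ≡⟨ cong (f x +_) (go xs) ⟩
      f x + (r + s)         ≡⟨ +-assoc (f x) r s ⟨
      f x + r + s           ≡⟨ cong (_+ s) (+-comm (f x) r) ⟩
      r + f x + s           ≡⟨ +-assoc r (f x) s ⟩
      r + (f x + s)         ∎
      where
      r s : ℕ
      r = sum (map (f ∘ value) (restrict (λ x → ¬? (P? x)) xs))
      s = sum (map (f ∘ value) (restrict P? xs))
    ... | no  _ = trans (cong (f x +_) (go xs)) (sym (+-assoc (f x) _ _))

  -- Cancellation without subtraction: after adding to each function, at `a`, the other one's value
  -- there, the two agree pointwise, and the equal totals cancel.
  ∑-determines : ∀ {f g : A → ℕ} a → (∀ x → x ≢ a → f x ≡ g x) → ∑ F f ≡ ∑ F g → f a ≡ g a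
  ∑-determines {f} {g} a off eq = sym (+-cancelˡ-≡ (∑ F f) (g a) (f a) (begin
    ∑ F f + g a                              ≡⟨ cong (∑ F f +_) (δ (g a)) ⟨
    ∑ F f + ∑ F (λ x → at x * g a)           ≡⟨ ∑-+ f _ ⟨
    ∑ F (λ x → f x + at x * g a)             ≡⟨ ∑-cong pointwise ⟩
    ∑ F (λ x → g x + at x * f a)             ≡⟨ ∑-+ g _ ⟩
    ∑ F g + ∑ F (λ x → at x * f a)           ≡⟨ cong₂ _+_ (sym eq) (δ (f a)) ⟩
    ∑ F f + f a                              ∎))
    where
    at : A → ℕ
    at x = ind (does (x ≟ a))
    δ : ∀ n → ∑ F (λ x → at x * n) ≡ n
    δ n = trans (∑-supported a λ x x≢a → cong (_* n) (ind-dec-false (x ≟ a) x≢a))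
                (trans (cong (_* n) (ind-dec-true (a ≟ a) refl)) (+-identityʳ n))
    pointwise : ∀ x → f x + at x * g a ≡ g x + at x * f a
    pointwise x with x ≟ a
    ... | yes refl = trans (cong (f a +_) (+-identityʳ (g a)))
                       (trans (+-comm (f a) (g a)) (cong (g a +_) (sym (+-identityʳ (f a)))))
    ... | no  x≢a  = cong (_+ 0) (off x x≢a)

∑-swap : ∀ (F : Finite A) (G : Finite B) (f : A → B → ℕ) →
         ∑ F (λ x → ∑ G (f x)) ≡ ∑ G (λ y → ∑ F (λ x → f x y))
∑-swap F G f = sum-swap f (elements F) (elements G)

∑-⊎ : ∀ (F : Finite A) (G : Finite B) (f : A ⊎ B → ℕ) →
      ∑ (finite-⊎ F G) f ≡ ∑ F (f ∘ inj₁) + ∑ G (f ∘ inj₂)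
∑-⊎ F G f = begin
  sum (map f (map inj₁ as ++ map inj₂ bs))
    ≡⟨ cong sum (map-++ f (map inj₁ as) (map inj₂ bs)) ⟩
  sum (map f (map inj₁ as) ++ map f (map inj₂ bs))
    ≡⟨ sum-++ (map f (map inj₁ as)) _ ⟩
  sum (map f (map inj₁ as)) + sum (map f (map inj₂ bs))
    ≡⟨ cong₂ (λ x y → sum x + sum y) (map-∘ as) (map-∘ bs) ⟨
  sum (map (f ∘ inj₁) as) + sum (map (f ∘ inj₂) bs) ∎
  where
  as : List _
  as = elements F
  bs : List _
  bs = elements G

-- The enumeration of `B` and the image of that of `A` are duplicate-free with the same members,
-- hence permutations of each other, and a sum ignores order.
∑-↔ : ∀ (F : Finite A) (G : Finite B) (φ : A ↔ B) (f : B → ℕ) →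
      ∑ G f ≡ ∑ F (f ∘ Inverse.to φ)
∑-↔ F G φ f = begin
  sum (map f (elements G))               ≡⟨ sum-↭ (↭.map⁺ f perm) ⟩
  sum (map f (map to (elements F)))      ≡⟨ cong sum (map-∘ (elements F)) ⟨
  sum (map (f ∘ to) (elements F))        ∎
  where
  open Inverse φ using (to; from; strictlyInverseˡ; strictlyInverseʳ)
  to-injective : ∀ {x y} → to x ≡ to y → x ≡ y
  to-injective {x} {y} eq = trans (sym (strictlyInverseʳ x)) (trans (cong from eq) (strictlyInverseʳ y))
  perm : elements G ↭ map to (elements F)
  perm = ∼bag⇒↭ (unique∧set⇒bag (Finite.unique G) (Unique.map⁺ to-injective (Finite.unique F))
    λ {y} → mk⇔ (λ _ → subst (_∈ map to (elements F)) (strictlyInverseˡ y)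
                          (∈-map⁺ to (Finite.complete F (from y))))
                (λ _ → Finite.complete G y))

-- Boolean subsets: difference, weighted size, one-element sets.

infixl 6 _∖_
_∖_ : (A → Bool) → (A → Bool) → A → Bool
(c ∖ d) x = c x ∧ not (d x)

T-∖ : ∀ (c d : A → Bool) {x} → T ((c ∖ d) x) → T (c x) × ¬ T (d x)
T-∖ c d {x} t with c x | d x
... | true | false = _ , λ ()

∖-T : ∀ (c d : A → Bool) {x} → T (c x) → ¬ T (d x) → T ((c ∖ d) x)
∖-T c d {x} t f with c x | d x
... | true | true  = f _
... | true | false = _

∨-∖ : ∀ (c d : A → Bool) → (∀ x → T (d x) → T (c x)) → ∀ x → c x ≡ d x ∨ (c ∖ d) x
∨-∖ c d d⊆c x with c x | d x | d⊆c x
... | true  | true  | _ = refl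
... | true  | false | _ = refl
... | false | true  | k = contradiction (k _) λ ()
... | false | false | _ = refl

module _ (F : Finite A) where
  open Finite F using (_≟_)

  -- One notion serves two purposes: for an edge set, weight `inc x` gives the degree at `x` and
  -- constant weight 1 gives the number of edges.
  ∑ₛ : (A → Bool) → (A → ℕ) → ℕ
  ∑ₛ c w = ∑ F (λ x → ind (c x) * w x)

  count : (A → Bool) → ℕ
  count c = ∑ₛ c (const 1)

  singleton : A → A → Bool
  singleton a x = does (x ≟ a)

  ∑ₛ-∖ : ∀ c d w → (∀ x → T (d x) → T (c x)) → ∑ₛ c w ≡ ∑ₛ d w + ∑ₛ (c ∖ d) w
  ∑ₛ-∖ c d w d⊆c = trans (∑-cong F pointwise) (∑-+ F _ _)
    where
    pointwise : ∀ x → ind (c x) * w x ≡ ind (d x) * w x + ind ((c ∖ d) x) * w x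
    pointwise x with c x | d x | d⊆c x
    ... | true  | true  | _ = sym (+-identityʳ (w x + 0))
    ... | true  | false | _ = refl
    ... | false | true  | k = contradiction (k _) λ ()
    ... | false | false | _ = refl

  ∑ₛ-remove : ∀ c w {a} → T (c a) → ∑ₛ c w ≡ w a + ∑ₛ (c ∖ singleton a) w
  ∑ₛ-remove c w {a} a∈c = trans (∑ₛ-∖ c (singleton a) w sub) (cong (_+ ∑ₛ (c ∖ singleton a) w) single)
    where
    sub : ∀ x → T (singleton a x) → T (c x)
    sub x t with x ≟ a
    ... | yes refl = a∈c
    single : ∑ₛ (singleton a) w ≡ w a
    single = begin
      ∑ₛ (singleton a) w                ≡⟨ ∑-supported F a (λ x x≢a → cong (λ n → n * w x) (ind-dec-false (x ≟ a) x≢a)) ⟩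
      ind (does (a ≟ a)) * w a          ≡⟨ cong (_* w a) (ind-dec-true (a ≟ a) refl) ⟩
      1 * w a                           ≡⟨ +-identityʳ (w a) ⟩
      w a                               ∎

  ∑ₛ-pick : ∀ c w {n} → ∑ₛ c w ≡ suc n → ∃[ x ] T (c x) × w x ≢ 0
  ∑ₛ-pick c w eq with sum-≢0 (λ x → ind (c x) * w x) (elements F) (λ z → contradiction (trans (sym z) eq) λ ())
  ... | x , ne = x , ind*≢0 ne

  -- Two distinct elements of weight 1, removed one after the other, would already account for a
  -- total of 2.
  ∑ₛ-unique : ∀ c w {a b} → ∑ₛ c w ≡ 1 → T (c a) → w a ≡ 1 → T (c b) → w b ≡ 1 → a ≡ b
  ∑ₛ-unique c w {a} {b} eq a∈c wa b∈c wb with b ≟ a in dec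
  ... | yes b≡a = sym b≡a
  ... | no  b≢a = contradiction (begin
    0                                              ≡⟨ suc-injective (trans (sym eq) (trans (∑ₛ-remove c w a∈c) (cong (_+ ∑ₛ c′ w) wa))) ⟩
    ∑ₛ c′ w                                        ≡⟨ ∑ₛ-remove c′ w b∈c′ ⟩
    w b + ∑ₛ (c′ ∖ singleton b) w                  ≡⟨ cong (_+ ∑ₛ (c′ ∖ singleton b) w) wb ⟩
    suc (∑ₛ (c′ ∖ singleton b) w)                  ∎) λ ()
    where
    c′ : A → Bool
    c′ = c ∖ singleton a
    b∈c′ : T (c′ b)
    b∈c′ with c b
    ... | true rewrite dec = _

  -- Serves to compare labels at `u` and `v`: a perfect matching uses one label at each, so one
  -- common label makes the matchings agree on all three.
  singletons-agree : ∀ {c d a} → count c ≡ 1 → count d ≡ 1 → T (c a) → T (d a) → ∀ x → c x ≡ d x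
  singletons-agree {c} {d} one-c one-d a∈c a∈d x with c x in cx | d x in dx
  ... | true  | true  = refl
  ... | false | false = refl
  ... | true  | false with ∑ₛ-unique c (const 1) one-c a∈c refl (subst T (sym cx) _) refl
  ...   | refl = contradiction (subst T dx a∈d) λ ()
  singletons-agree {c} {d} one-c one-d a∈c a∈d x | false | true
    with ∑ₛ-unique d (const 1) one-d a∈d refl (subst T (sym dx) _) refl
  ...   | refl = contradiction (subst T cx a∈c) λ ()

-- Degrees, parity and bipartite counting

module _ (G : Multigraph) where
  open Multigraph G

  inc : V → E → ℕ
  inc x e = ind (does (incident? x e))

  degreeIn-∑ : ∀ S x → degreeIn S x ≡ ∑ₛ finite-E S (inc x)
  degreeIn-∑ S x = trans (sum-filter _ (elements finite-E)) (∑-cong finite-E pointwise)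
    where
    pointwise : ∀ e → ind (S e ∧ does (incident? x e)) ≡ ind (S e) * inc x e
    pointwise e with S e
    ... | true  = sym (+-identityʳ _)
    ... | false = refl

  degreeIn-∖ : ∀ {S S′} → S′ ⊆ᴱ S → ∀ x → degreeIn S x ≡ degreeIn S′ x + degreeIn (S ∖ S′) x
  degreeIn-∖ {S} {S′} sub x = begin
    degreeIn S x                                                  ≡⟨ degreeIn-∑ S x ⟩
    ∑ₛ finite-E S (inc x)                                         ≡⟨ ∑ₛ-∖ finite-E S S′ (inc x) sub ⟩
    ∑ₛ finite-E S′ (inc x) + ∑ₛ finite-E (S ∖ S′) (inc x)         ≡⟨ cong₂ _+_ (degreeIn-∑ S′ x) (degreeIn-∑ (S ∖ S′) x) ⟨
    degreeIn S′ x + degreeIn (S ∖ S′) x                           ∎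

  infixl 6 _-_
  _-_ : EdgeSet → E → EdgeSet
  S - e = S ∖ singleton finite-E e

  -⊆ : ∀ S e → (S - e) ⊆ᴱ S
  -⊆ S e f t = proj₁ (T-∖ S (singleton finite-E e) t)

  degreeIn-remove : ∀ {S e} → e ∈ᴱ S → ∀ x → degreeIn S x ≡ inc x e + degreeIn (S - e) x
  degreeIn-remove {S} {e} e∈S x = begin
    degreeIn S x                                   ≡⟨ degreeIn-∑ S x ⟩
    ∑ₛ finite-E S (inc x)                          ≡⟨ ∑ₛ-remove finite-E S (inc x) e∈S ⟩
    inc x e + ∑ₛ finite-E (S - e) (inc x)          ≡⟨ cong (inc x e +_) (degreeIn-∑ (S - e) x) ⟨
    inc x e + degreeIn (S - e) x                   ∎

  incidentEdge : ∀ S x {n} → degreeIn S x ≡ suc n → ∃[ e ] e ∈ᴱ S × Incident x e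
  incidentEdge S x eq with ∑ₛ-pick finite-E S (inc x) (trans (sym (degreeIn-∑ S x)) eq)
  ... | e , e∈S , ne = e , e∈S , ind-does≢0 (incident? x e) ne

  incidentEdge-unique : ∀ S {x e f} → degreeIn S x ≡ 1 → e ∈ᴱ S → Incident x e →
                        f ∈ᴱ S → Incident x f → e ≡ f
  incidentEdge-unique S {x} {e} {f} deg e∈S xe f∈S xf =
    ∑ₛ-unique finite-E S (inc x) (trans (sym (degreeIn-∑ S x)) deg)
      e∈S (ind-dec-true (incident? x e) xe) f∈S (ind-dec-true (incident? x f) xf)

  -- Walks, and Hamiltonian cycles with one edge removed.

  Joins : E → V → V → Set
  Joins e x y = (x ≡ end₁ e × y ≡ end₂ e) ⊎ (x ≡ end₂ e × y ≡ end₁ e)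

  joins-sym : ∀ {e x y} → Joins e x y → Joins e y x
  joins-sym (inj₁ (p , q)) = inj₂ (q , p)
  joins-sym (inj₂ (p , q)) = inj₁ (q , p)

  adjacent-sym : ∀ {S x y} → Adjacent S x y → Adjacent S y x
  adjacent-sym (e , e∈S , j) = e , e∈S , joins-sym j

  incidentˡ : ∀ {e x y} → Joins e x y → Incident x e
  incidentˡ (inj₁ (p , _)) = inj₁ p
  incidentˡ (inj₂ (p , _)) = inj₂ p

  incident-joins : ∀ {e x y z} → Joins e x y → Incident z e → z ≡ x ⊎ z ≡ y
  incident-joins (inj₁ (refl , refl)) (inj₁ p) = inj₁ p
  incident-joins (inj₁ (refl , refl)) (inj₂ p) = inj₂ p
  incident-joins (inj₂ (refl , refl)) (inj₁ p) = inj₂ p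
  incident-joins (inj₂ (refl , refl)) (inj₂ p) = inj₁ p

  joins-≢ : ∀ {e x y} → Joins e x y → x ≢ y
  joins-≢ {e} (inj₁ (refl , refl)) eq = loopless e eq
  joins-≢ {e} (inj₂ (refl , refl)) eq = loopless e (sym eq)

  otherEnd-joins : ∀ {e x} → Incident x e → Joins e x (otherEnd x e)
  otherEnd-joins {e} {x} i with x ≟ end₁ e
  otherEnd-joins i        | yes p = inj₁ (p , refl)
  otherEnd-joins (inj₁ p) | no ¬p = contradiction p ¬p
  otherEnd-joins (inj₂ p) | no ¬p = inj₂ (p , refl)

  otherEnd-unique : ∀ {e x y} → Joins e x y → otherEnd x e ≡ y
  otherEnd-unique {e} {x} {y} j with incident-joins j (incidentˡ (joins-sym (otherEnd-joins (incidentˡ j))))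
  ... | inj₁ eq = contradiction eq (otherEnd-≢ (incidentˡ j))
  ... | inj₂ eq = eq

  Odd : EdgeSet → V → Set
  Odd S x = parity (degreeIn S x) ≡ 1ℙ

  -- Follow an edge out of x and delete it: x becomes even and the parity of
  -- the other end flips, so either that end was odd already or the search
  -- continues from it.
  oddWalk : ∀ n S x → count finite-E S ≡ n → Odd S x →
            ∃[ y ] y ≢ x × Odd S y × Star (Adjacent S) x y
  oddWalk n S x size odd-x with degreeIn S x in deg
  ... | suc m = go n size (incidentEdge S x deg)
    where
    go : ∀ n → count finite-E S ≡ n → ∃[ e ] e ∈ᴱ S × Incident x e →
         ∃[ y ] y ≢ x × Odd S y × Star (Adjacent S) x y
    go n size (e , e∈S , xe) = step n size (parity (degreeIn S y)) refl
      where
      y : V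
      y = otherEnd x e
      xy : Joins e x y
      xy = otherEnd-joins xe
      x–y : Adjacent S x y
      x–y = e , e∈S , xy
      drop : ∀ z → Incident z e → degreeIn S z ≡ suc (degreeIn (S - e) z)
      drop z ze = trans (degreeIn-remove e∈S z) (cong (_+ degreeIn (S - e) z) (ind-dec-true (incident? z e) ze))
      flip : ∀ z {p} → Incident z e → parity (degreeIn S z) ≡ p → p ⁻¹ ≡ parity (degreeIn (S - e) z)
      flip z ze refl = trans (cong (λ k → parity k ⁻¹) (drop z ze)) (suc-homo-⁻¹ (degreeIn (S - e) z))
      -- The number `n` of edges bounds the recursion; the value zero is ruled out by `e` itself.
      step : ∀ n → count finite-E S ≡ n → ∀ p → parity (degreeIn S y) ≡ p →
             ∃[ y ] y ≢ x × Odd S y × Star (Adjacent S) x y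
      step _       _    1ℙ odd-y  = y , joins-≢ (joins-sym xy) , odd-y , x–y ◅ ε
      step zero    size 0ℙ _      =
        contradiction (trans (sym size) (∑ₛ-remove finite-E S (const 1) e∈S)) λ ()
      step (suc n) size 0ℙ even-y
        with oddWalk n (S - e) y
               (suc-injective (trans (sym (∑ₛ-remove finite-E S (const 1) e∈S)) size))
               (sym (flip y (incidentˡ (joins-sym xy)) even-y))
      ... | z , z≢y , odd-z , walk =
        z , z≢x , trans (cong parity (trans (degreeIn-remove e∈S z) (cong (_+ degreeIn (S - e) z) (ind-dec-false (incident? z e) ¬ze)))) odd-z
          , x–y ◅ Star.map (λ (f , f∈ , j) → f , -⊆ S e f f∈ , j) walk
        where
        -- In `S - e` the vertex `x` is even while `z` is odd.
        z≢x : z ≢ x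
        z≢x refl = contradiction (trans (flip x xe (trans (cong parity deg) odd-x)) odd-z) λ ()
        ¬ze : ¬ Incident z e
        ¬ze ze with incident-joins xy ze
        ... | inj₁ z≡x = z≢x z≡x
        ... | inj₂ z≡y = z≢y z≡y

  -- An edge of a 2-regular graph is no bridge: once `e` is deleted, only its ends `a` and `b` have
  -- odd degree, so the odd walk from `a` has to stop at `b`.
  detour : ∀ {H e a b} → Regular 2 H → e ∈ᴱ H → Joins e a b → Star (Adjacent (H - e)) a b
  detour {H} {e} {a} {b} reg e∈H ab =
    let z , z≢a , odd-z , walk = oddWalk _ (H - e) a refl (cong parity deg-a)
    in subst (Star (Adjacent (H - e)) a) (end z z≢a odd-z) walk
    where
    deg-a : degreeIn (H - e) a ≡ 1
    deg-a = suc-injective (begin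
      suc (degreeIn (H - e) a)       ≡⟨ cong (_+ degreeIn (H - e) a) (ind-dec-true (incident? a e) (incidentˡ ab)) ⟨
      inc a e + degreeIn (H - e) a   ≡⟨ degreeIn-remove e∈H a ⟨
      degreeIn H a                   ≡⟨ reg a ⟩
      2                              ∎)
    end : ∀ z → z ≢ a → Odd (H - e) z → z ≡ b
    end z z≢a odd-z with incident? z e in dec
    ... | no _   = contradiction (trans (sym odd-z) (cong parity (begin
      degreeIn (H - e) z             ≡⟨ cong (λ d → ind (does d) + degreeIn (H - e) z) dec ⟨
      inc z e + degreeIn (H - e) z   ≡⟨ degreeIn-remove e∈H z ⟨
      degreeIn H z                   ≡⟨ reg z ⟩
      2                              ∎))) λ ()
    ... | yes ze with incident-joins ab ze
    ...   | inj₁ z≡a = contradiction z≡a z≢a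
    ...   | inj₂ z≡b = z≡b

  -- Every passage through `e` in a walk, in either direction, is replaced by a `detour`.
  cycle-edge-connected : ∀ {H} → HamiltonianCycle H → ∀ {e} → e ∈ᴱ H → ConnectedBy (H - e)
  cycle-edge-connected {H} (conn , reg) {e} e∈H x y = (reroute Star.⋆) (conn x y)
    where
    reroute : ∀ {x y} → Adjacent H x y → Star (Adjacent (H - e)) x y
    reroute (f , f∈H , xy) with Finite._≟_ finite-E f e in dec
    ... | yes refl = detour reg f∈H xy
    ... | no  _    = (f , kept , xy) ◅ ε
      where
      kept : f ∈ᴱ (H - e)
      kept rewrite dec with H f
      ... | true = _

  -- Double counting in bipartite graphs.

  -- Exchanging the order of summation, each edge of `S` is counted once, since exactly one of its
  -- ends lies on the chosen side.
  side-sum : ∀ (side : V → Bool) → (∀ e → side (end₁ e) ≢ side (end₂ e)) → ∀ S →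
             ∑ₛ finite-V side (degreeIn S) ≡ count finite-E S
  side-sum side bip S = begin
    ∑ finite-V (λ x → ind (side x) * degreeIn S x)
      ≡⟨ ∑-cong finite-V (λ x → expand x) ⟩
    ∑ finite-V (λ x → ∑ finite-E (λ e → ind (side x) * (ind (S e) * inc x e)))
      ≡⟨ ∑-swap finite-V finite-E _ ⟩
    ∑ finite-E (λ e → ∑ finite-V (λ x → ind (side x) * (ind (S e) * inc x e)))
      ≡⟨ ∑-cong finite-E (λ e → collect e) ⟩
    ∑ finite-E (λ e → ind (S e) * 1) ∎
    where
    at : V → V → ℕ
    at a x = ind (does (x ≟ a))
    expand : ∀ x → ind (side x) * degreeIn S x ≡ ∑ finite-E (λ e → ind (side x) * (ind (S e) * inc x e))
    expand x = trans (cong (ind (side x) *_) (degreeIn-∑ S x)) (sym (sum-* (ind (side x)) _ (elements finite-E)))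
    inc-ends : ∀ x e → inc x e ≡ at (end₁ e) x + at (end₂ e) x
    inc-ends x e with x ≟ end₁ e | x ≟ end₂ e
    ... | yes p | yes q = contradiction (trans (sym p) q) (loopless e)
    ... | yes _ | no  _ = refl
    ... | no  _ | yes _ = refl
    ... | no  _ | no  _ = refl
    side-at : ∀ a → ∑ finite-V (λ x → ind (side x) * at a x) ≡ ind (side a)
    side-at a = begin
      ∑ finite-V (λ x → ind (side x) * at a x)
        ≡⟨ ∑-supported finite-V a (λ x x≢a → trans (cong (ind (side x) *_) (ind-dec-false (x ≟ a) x≢a)) (*-zeroʳ (ind (side x)))) ⟩
      ind (side a) * at a a    ≡⟨ cong (ind (side a) *_) (ind-dec-true (a ≟ a) refl) ⟩
      ind (side a) * 1         ≡⟨ *-identityʳ (ind (side a)) ⟩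
      ind (side a)             ∎
    opposite : ∀ b c → b ≢ c → ind b + ind c ≡ 1
    opposite true  true  ne = contradiction refl ne
    opposite true  false _  = refl
    opposite false true  _  = refl
    opposite false false ne = contradiction refl ne
    one-end : ∀ e → ∑ finite-V (λ x → ind (side x) * inc x e) ≡ 1
    one-end e = begin
      ∑ finite-V (λ x → ind (side x) * inc x e)
        ≡⟨ ∑-cong finite-V (λ x → trans (cong (ind (side x) *_) (inc-ends x e)) (*-distribˡ-+ (ind (side x)) _ _)) ⟩
      ∑ finite-V (λ x → ind (side x) * at (end₁ e) x + ind (side x) * at (end₂ e) x)
        ≡⟨ ∑-+ finite-V _ _ ⟩
      ∑ finite-V (λ x → ind (side x) * at (end₁ e) x) + ∑ finite-V (λ x → ind (side x) * at (end₂ e) x)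
        ≡⟨ cong₂ _+_ (side-at (end₁ e)) (side-at (end₂ e)) ⟩
      ind (side (end₁ e)) + ind (side (end₂ e))
        ≡⟨ opposite _ _ (bip e) ⟩
      1 ∎
    collect : ∀ e → ∑ finite-V (λ x → ind (side x) * (ind (S e) * inc x e)) ≡ ind (S e) * 1
    collect e = begin
      ∑ finite-V (λ x → ind (side x) * (ind (S e) * inc x e))
        ≡⟨ ∑-cong finite-V (λ x → x∙yz≈y∙xz (ind (side x)) (ind (S e)) (inc x e)) ⟩
      ∑ finite-V (λ x → ind (S e) * (ind (side x) * inc x e))
        ≡⟨ sum-* (ind (S e)) _ (elements finite-V) ⟩
      ind (S e) * ∑ finite-V (λ x → ind (side x) * inc x e)
        ≡⟨ cong (ind (S e) *_) (one-end e) ⟩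
      ind (S e) * 1 ∎

  -- The side not containing w is counted by the edges of S and by those of
  -- a perfect matching alike, so these have equal size; on the side of w the
  -- two degree sums then agree too, and only the term of w is in doubt.
  bipartite-degree : Bipartite → HasPerfectMatching → ∀ S w →
                     (∀ x → x ≢ w → degreeIn S x ≡ 1) → degreeIn S w ≡ 1
  bipartite-degree (side , bip) (M , pm) S w deg = helper (side w) refl
    where
    compare : ∀ (near far : V → Bool) → (∀ e → near (end₁ e) ≢ near (end₂ e)) →
              (∀ e → far (end₁ e) ≢ far (end₂ e)) → near w ≡ true → far w ≡ false → degreeIn S w ≡ 1
    compare near far bip-near bip-far near-w far-w = begin
      degreeIn S w                         ≡⟨ *-identityˡ _ ⟨
      1 * degreeIn S w                     ≡⟨ cong (λ b → ind b * degreeIn S w) near-w ⟨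
      ind (near w) * degreeIn S w          ≡⟨ ∑-determines finite-V {f = λ x → ind (near x) * degreeIn S x} w
                                                (λ x x≢w → cong (ind (near x) *_) (trans (deg x x≢w) (sym (pm x)))) near-sums ⟩
      ind (near w) * degreeIn M w          ≡⟨ cong (λ b → ind b * degreeIn M w) near-w ⟩
      1 * degreeIn M w                     ≡⟨ *-identityˡ _ ⟩
      degreeIn M w                         ≡⟨ pm w ⟩
      1                                    ∎
      where
      far-terms : ∀ x → ind (far x) * degreeIn S x ≡ ind (far x) * degreeIn M x
      far-terms x with x ≟ w
      -- Both terms vanish, as `w` is not on the far side.
      ... | yes refl rewrite far-w = refl
      ... | no  x≢w = cong (ind (far x) *_) (trans (deg x x≢w) (sym (pm x)))
      near-sums : ∑ₛ finite-V near (degreeIn S) ≡ ∑ₛ finite-V near (degreeIn M)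
      near-sums = begin
        ∑ₛ finite-V near (degreeIn S)  ≡⟨ side-sum near bip-near S ⟩
        count finite-E S               ≡⟨ side-sum far bip-far S ⟨
        ∑ₛ finite-V far (degreeIn S)   ≡⟨ ∑-cong finite-V far-terms ⟩
        ∑ₛ finite-V far (degreeIn M)   ≡⟨ side-sum far bip-far M ⟩
        count finite-E M               ≡⟨ side-sum near bip-near M ⟨
        ∑ₛ finite-V near (degreeIn M)  ∎
    helper : ∀ b → side w ≡ b → degreeIn S w ≡ 1
    helper true  eq = compare side (not ∘ side) bip (λ e → bip e ∘ not-injective) eq (cong not eq)
    helper false eq = compare (not ∘ side) side (λ e → bip e ∘ not-injective) bip (cong not eq) eq

  -- Perfect matchings inside Hamiltonian cycles.

  matching-complement : ∀ {M H} → PerfectMatching M → Regular 2 H → M ⊆ᴱ H → PerfectMatching (H ∖ M)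
  matching-complement {M} {H} pm reg M⊆H x = suc-injective (begin
    suc (degreeIn (H ∖ M) x)             ≡⟨ cong (_+ degreeIn (H ∖ M) x) (pm x) ⟨
    degreeIn M x + degreeIn (H ∖ M) x    ≡⟨ degreeIn-∖ M⊆H x ⟨
    degreeIn H x                         ≡⟨ reg x ⟩
    2                                    ∎)

  -- If the given matching `M` misses `e`, malleability puts `e` on a cycle extending `M`, and the
  -- edges of that cycle outside `M` form a perfect matching through `e`.
  malleable-matching : ∀ {t v e} → Malleable t v → Incident v e → ∃[ M ] PerfectMatching M × e ∈ᴱ M
  malleable-matching {e = e} (_ , _ , (M , pm) , cycles) ve with T? (M e) | cycles M pm
  ... | yes e∈M | _ = M , pm , e∈M
  ... | no  e∉M | H , ham , cover with cover e ve e∉M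
  ...   | k , e∈H with ham k
  ...     | (_ , reg) , M⊆H = H k ∖ M , matching-complement pm reg M⊆H , ∖-T (H k) M e∈H e∉M

-- Deleting a vertex

module _ (G : Multigraph) (w : Multigraph.V G) where
  open Multigraph G
  open Delete G w

  deleteVertex : Multigraph
  deleteVertex = record
    { V        = V⁻
    ; E        = E⁻
    ; finite-V = finite-V⁻
    ; finite-E = finite-E⁻
    ; end₁     = end₁⁻
    ; end₂     = end₂⁻
    ; loopless = λ e → loopless (value e) ∘ cong value
    }

  private module G⁻ = Multigraph deleteVertex

  -- The walk is cut where it first meets `w`. All earlier edges survive the deletion, and the edge
  -- of arrival determines the neighbour at which the shortened walk ends. The inequality is
  -- irrelevant because vertices of the deleted graph carry it irrelevantly.
  firstArrival : ∀ {S x} → Star (Adjacent S) x w → .(x≢w : x ≢ w) →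
                 ∃[ e ] e ∈ᴱ S × Σ[ we ∈ Incident w e ]
                   Star (G⁻.Adjacent (S ∘ value)) (x , [ x≢w ]) (neighbourAlong (e , [ we ]))
  firstArrival ε x≢w = Irrelevant.⊥-elim (x≢w refl)
  firstArrival {S} {x} (_◅_ {j = y} (e , e∈S , xy) walk) x≢w with y ≟ w
  -- This step enters `w`, so `x` is already the neighbour along `e` and the remaining walk is
  -- empty.
  ... | yes refl = e , e∈S , incidentˡ G (joins-sym G xy) ,
                   subst (Star (G⁻.Adjacent (S ∘ value)) (x , [ x≢w ]))
                     (value-injective (sym (otherEnd-unique G (joins-sym G xy)))) ε
  ... | no y≢w with firstArrival walk y≢w
  ...   | f , f∈S , wf , walk⁻ = f , f∈S , wf , ((e , [ avoids x≢w ]) , e∈S , lift xy) ◅ walk⁻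
    where
    avoids : x ≢ w → ¬ Incident w e
    avoids x≢w we with incident-joins G xy we
    ... | inj₁ w≡x = x≢w (sym w≡x)
    ... | inj₂ w≡y = y≢w (sym w≡y)
    lift : Joins G e x y → Joins deleteVertex (e , [ avoids x≢w ]) (x , [ x≢w ]) (y , [ y≢w ])
    lift (inj₁ (p , q)) = inj₁ (value-injective p , value-injective q)
    lift (inj₂ (p , q)) = inj₂ (value-injective p , value-injective q)

  -- Without one of its two edges at w the cycle is still connected and can
  -- reach w only along the other one, hence through a fixed neighbour of w.
  cycle-vertex-connected : ∀ {H} → HamiltonianCycle H → G⁻.ConnectedBy (H ∘ value)
  cycle-vertex-connected {H} ham@(_ , reg) (x , [ x≢w ]) (y , [ y≢w ])
    with incidentEdge G H w (reg w)
  ... | e , e∈H , we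
    with firstArrival (cycle-edge-connected G ham e∈H x w) x≢w
       | firstArrival (cycle-edge-connected G ham e∈H y w) y≢w
  ... | f , f∈ , wf , walk-x | g , g∈ , wg , walk-y
    with incidentEdge-unique G (_-_ G H e) deg f∈ wf g∈ wg
    where
    deg : degreeIn (_-_ G H e) w ≡ 1
    deg = suc-injective (trans (cong (_+ degreeIn (_-_ G H e) w) (sym (ind-dec-true (incident? w e) we)))
                          (trans (sym (degreeIn-remove G e∈H w)) (reg w)))
  ... | refl = Star.map restore walk-x ◅◅ Star.reverse (λ {a} {b} → G⁻-sym {a} {b}) (Star.map restore walk-y)
    where
    restore : ∀ {a b} → G⁻.Adjacent (_-_ G H e ∘ value) a b → G⁻.Adjacent (H ∘ value) a b
    restore (f , f∈ , j) = f , -⊆ G H e (value f) f∈ , j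
    G⁻-sym : ∀ {a b} → G⁻.Adjacent (H ∘ value) a b → G⁻.Adjacent (H ∘ value) b a
    G⁻-sym = adjacent-sym deleteVertex

  -- Edge sets of a graph described by the surviving edges and the labels at the deleted vertex.

  module _ (α : Ordering w) where
    open Inverse α using (to; from; strictlyInverseʳ)

    -- The degree of x in the graph obtained from an edge set of the deleted
    -- graph by attaching the i-th edge at w, seen from its far end, when c i.
    splitDegree : G⁻.EdgeSet → (Fin 3 → Bool) → V⁻ → ℕ
    splitDegree S c x =
      G⁻.degreeIn S x + ∑ₛ (finite-Fin 3) c (λ i → ind (does (Finite._≟_ finite-V⁻ x (neighbour α i))))

    splitDegree-cong : ∀ {S S′ c c′} → (∀ e → S e ≡ S′ e) → (∀ i → c i ≡ c′ i) →
                       ∀ x → splitDegree S c x ≡ splitDegree S′ c′ x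
    splitDegree-cong {S} {S′} S≗S′ c≗c′ x = cong₂ _+_
      (begin
        G⁻.degreeIn S x                                                  ≡⟨ degreeIn-∑ deleteVertex S x ⟩
        ∑ₛ finite-E⁻ S (inc deleteVertex x)                              ≡⟨ ∑-cong finite-E⁻ (λ e → cong (λ b → ind b * inc deleteVertex x e) (S≗S′ e)) ⟩
        ∑ₛ finite-E⁻ S′ (inc deleteVertex x)                             ≡⟨ degreeIn-∑ deleteVertex S′ x ⟨
        G⁻.degreeIn S′ x                                                 ∎)
      (∑-cong (finite-Fin 3) λ i → cong (λ b → ind b * ind (does (Finite._≟_ finite-V⁻ x (neighbour α i)))) (c≗c′ i))

    degreeIn-split : ∀ S x → degreeIn S x ≡
                     ∑ₛ finite-E⁻ (S ∘ value) (inc G x ∘ value) +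
                     ∑ₛ (finite-Fin 3) (S ∘ value ∘ to) (inc G x ∘ value ∘ to)
    degreeIn-split S x = begin
      degreeIn S x                      ≡⟨ degreeIn-∑ G S x ⟩
      ∑ₛ finite-E S (inc G x)           ≡⟨ ∑-refine finite-E (incident? w) (λ e → ind (S e) * inc G x e) ⟩
      ∑ₛ finite-E⁻ (S ∘ value) (inc G x ∘ value) + ∑ₛ (finite-Refinement (incident? w) finite-E) (S ∘ value) (inc G x ∘ value)
        ≡⟨ cong (∑ₛ finite-E⁻ (S ∘ value) (inc G x ∘ value) +_)
             (∑-↔ (finite-Fin 3) (finite-Refinement (incident? w) finite-E) α (λ e → ind (S (value e)) * inc G x (value e))) ⟩
      ∑ₛ finite-E⁻ (S ∘ value) (inc G x ∘ value) + ∑ₛ (finite-Fin 3) (S ∘ value ∘ to) (inc G x ∘ value ∘ to) ∎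

    -- An edge at `w` is incident to a surviving vertex exactly when that vertex is its far end.
    degreeIn-≢ : ∀ S x → degreeIn S (value x) ≡ splitDegree (S ∘ value) (S ∘ value ∘ to) x
    degreeIn-≢ S x@(x′ , [ x≢w ]) = trans (degreeIn-split S x′) (cong₂ _+_
      (sym (degreeIn-∑ deleteVertex (S ∘ value) x))
      (∑-cong (finite-Fin 3) λ i → cong (λ b → ind (S (value (to i))) * ind b) (far-end (to i))))
      where
      far-end : ∀ e → does (incident? x′ (value e)) ≡ does (Finite._≟_ finite-V⁻ x (neighbourAlong e))
      far-end (e , [ we ]) = does-⇔ (mk⇔ forth back) (incident? x′ e) (Finite._≟_ finite-V⁻ x (neighbourAlong (e , [ we ])))
        where
        j : Joins G e w (otherEnd w e)
        -- The stored incidence proof is irrelevant; decidability recovers a usable one.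
        j = otherEnd-joins G (recompute (incident? w e) we)
        forth : Incident x′ e → x ≡ neighbourAlong (e , [ we ])
        forth xe with incident-joins G j xe
        ... | inj₁ x≡w = Irrelevant.⊥-elim (x≢w x≡w)
        ... | inj₂ eq  = value-injective eq
        back : x ≡ neighbourAlong (e , [ we ]) → Incident x′ e
        back refl = incidentˡ G (joins-sym G j)

    degreeIn-centre : ∀ S → degreeIn S w ≡ count (finite-Fin 3) (S ∘ value ∘ to)
    degreeIn-centre S = trans (degreeIn-split S w) (cong₂ _+_
      (∑-zero finite-E⁻ λ (e , [ ¬we ]) → trans
        (cong (ind (S e) *_) (ind-dec-false (incident? w e) λ we → Irrelevant.⊥-elim (¬we we)))
        (*-zeroʳ (ind (S e))))
      (∑-cong (finite-Fin 3) λ i → cong (ind (S (value (to i))) *_) (at-centre (to i))))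
      where
      at-centre : ∀ e → inc G w (value e) ≡ 1
      at-centre (e , [ we ]) = ind-dec-true (incident? w e) (recompute (incident? w e) we)

    -- For `S` and `c` read off an edge set of a star product, this is the result of contracting the
    -- other factor to `w`: cut edges become the edges at `w` with the same labels.
    extend : G⁻.EdgeSet → (Fin 3 → Bool) → EdgeSet
    extend S c e with incident? w e
    ... | yes we = c (from (e , [ we ]))
    ... | no ¬we = S (e , [ ¬we ])

    extend-value : ∀ S c e → extend S c (value e) ≡ S e
    extend-value S c (e , [ ¬we ]) with incident? w e
    ... | yes we = Irrelevant.⊥-elim (¬we we)
    ... | no _   = refl

    extend-to : ∀ S c i → extend S c (value (to i)) ≡ c i
    -- Generalised from `to i` to any `e` that `from` sends to `i`, so that `e` can be split into an
    -- edge and its incidence proof.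
    extend-to S c i = go (to i) (strictlyInverseʳ i)
      where
      go : ∀ e → from e ≡ i → extend S c (value e) ≡ c i
      go (e , [ we ]) eq with incident? w e
      ... | yes _  = cong c eq
      ... | no ¬we = Irrelevant.⊥-elim (¬we we)

    extend-≢ : ∀ S c x → degreeIn (extend S c) (value x) ≡ splitDegree S c x
    extend-≢ S c x = trans (degreeIn-≢ (extend S c) x) (splitDegree-cong (extend-value S c) (extend-to S c) x)

    extend-centre : ∀ S c → degreeIn (extend S c) w ≡ count (finite-Fin 3) c
    extend-centre S c = trans (degreeIn-centre (extend S c))
      (∑-cong (finite-Fin 3) λ i → cong (λ b → ind b * 1) (extend-to S c i))

    extend-regular : ∀ {k S c} → (∀ x → splitDegree S c x ≡ k) → count (finite-Fin 3) c ≡ k →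
                     Regular k (extend S c)
    extend-regular {S = S} {c} off at x with x ≟ w
    ... | yes refl = trans (extend-centre S c) at
    ... | no x≢w   = trans (extend-≢ S c (x , [ x≢w ])) (off (x , [ x≢w ]))

    -- The number of labels in `c` is the degree of `w` in the contracted edge set, which
    -- `bipartite-degree` forces to be 1.
    bipartite-split : Bipartite → HasPerfectMatching → ∀ S c → (∀ x → splitDegree S c x ≡ 1) →
                      count (finite-Fin 3) c ≡ 1
    bipartite-split bip pm S c off = trans (sym (extend-centre S c))
      (bipartite-degree G bip pm (extend S c) w λ x x≢w →
        trans (extend-≢ S c (x , [ x≢w ])) (off (x , [ x≢w ])))

    extend-⊆ : ∀ S c {H} → extend S c ⊆ᴱ H → (∀ e → T (S e) → T (H (value e))) × (∀ i → T (c i) → T (H (value (to i))))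
    extend-⊆ S c sub = (λ e → sub (value e) ∘ subst T (sym (extend-value S c e)))
                     , (λ i → sub (value (to i)) ∘ subst T (sym (extend-to S c i)))

-- Splicing edge sets of the factors

module _ (G₁ G₂ : Multigraph) (u : Multigraph.V G₁) (v : Multigraph.V G₂)
         (α : Multigraph.Ordering G₁ u) (β : Multigraph.Ordering G₂ v) where
  open StarProduct G₁ G₂ u v α β hiding (starProduct)

  private
    module G₁ = Multigraph G₁
    module G₂ = Multigraph G₂
    module D₁ = Multigraph (deleteVertex G₁ u)
    module D₂ = Multigraph (deleteVertex G₂ v)

    G : Multigraph
    G = starProduct G₁ G₂ u v α β

    module G* = Multigraph G

    e₁ : Fin 3 → G₁.E
    e₁ = value ∘ Inverse.to α
    e₂ : Fin 3 → G₂.E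
    e₂ = value ∘ Inverse.to β

  incident-e₂ : ∀ i → G₂.Incident v (e₂ i)
  incident-e₂ i with Inverse.to β i
  ... | e , [ ve ] = recompute (G₂.incident? v e) ve

  sideˡ : G*.EdgeSet → D₁.EdgeSet
  sideˡ S = S ∘ inj₁

  sideʳ : G*.EdgeSet → D₂.EdgeSet
  sideʳ S = S ∘ inj₂ ∘ inj₁

  cut : G*.EdgeSet → Fin 3 → Bool
  cut S = S ∘ inj₂ ∘ inj₂

  degreeIn-star : ∀ S x → G*.degreeIn S x ≡
    ∑ₛ L.finite-E⁻ (sideˡ S) (inc G x ∘ inj₁) +
    (∑ₛ R.finite-E⁻ (sideʳ S) (inc G x ∘ inj₂ ∘ inj₁) +
     ∑ₛ (finite-Fin 3) (cut S) (inc G x ∘ inj₂ ∘ inj₂))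
  degreeIn-star S x = trans (degreeIn-∑ G S x) (trans
    (∑-⊎ L.finite-E⁻ (finite-⊎ R.finite-E⁻ (finite-Fin 3)) (λ e → ind (S e) * inc G x e))
    (cong (∑ₛ L.finite-E⁻ (sideˡ S) (inc G x ∘ inj₁) +_)
      (∑-⊎ R.finite-E⁻ (finite-Fin 3) (λ e → ind (S (inj₂ e)) * inc G x (inj₂ e)))))

  degreeIn-inj₁ : ∀ S x → G*.degreeIn S (inj₁ x) ≡ splitDegree G₁ u α (sideˡ S) (cut S) x
  degreeIn-inj₁ S x = trans (degreeIn-star S (inj₁ x)) (cong₂ _+_
    (sym (degreeIn-∑ (deleteVertex G₁ u) (sideˡ S) x))
    (cong₂ _+_
      (∑-zero R.finite-E⁻ λ e → *-zeroʳ (ind (sideʳ S e)))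
      -- A cut edge meets the left factor at `end₁*` only, so the second disjunct of its incidence
      -- test is `false`.
      (∑-cong (finite-Fin 3) λ i → cong (λ b → ind (cut S i) * ind b)
        (∨-identityʳ (does (Finite._≟_ L.finite-V⁻ x (L.neighbour α i)))))))

  degreeIn-inj₂ : ∀ S x → G*.degreeIn S (inj₂ x) ≡ splitDegree G₂ v β (sideʳ S) (cut S) x
  degreeIn-inj₂ S x = trans (degreeIn-star S (inj₂ x)) (cong₂ _+_
    (∑-zero L.finite-E⁻ λ e → *-zeroʳ (ind (sideˡ S e)))
    (cong (_+ ∑ₛ (finite-Fin 3) (cut S) (inc G (inj₂ x) ∘ inj₂ ∘ inj₂))
      (sym (degreeIn-∑ (deleteVertex G₂ v) (sideʳ S) x))))

  -- Cut edges are read off `S₁`. This treats the factors alike once `S₁` and `S₂` agree on labels,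
  -- as `glue-regular` assumes.
  glue : G₁.EdgeSet → G₂.EdgeSet → G*.EdgeSet
  glue S₁ S₂ (inj₁ e)        = S₁ (value e)
  glue S₁ S₂ (inj₂ (inj₁ e)) = S₂ (value e)
  glue S₁ S₂ (inj₂ (inj₂ i)) = S₁ (e₁ i)

  glue-regular : ∀ {k S₁ S₂} → (∀ i → S₁ (e₁ i) ≡ S₂ (e₂ i)) →
                 G₁.Regular k S₁ → G₂.Regular k S₂ → G*.Regular k (glue S₁ S₂)
  glue-regular {S₁ = S₁} {S₂} agree reg₁ reg₂ (inj₁ x) =
    trans (degreeIn-inj₁ (glue S₁ S₂) x) (trans (sym (degreeIn-≢ G₁ u α S₁ x)) (reg₁ (value x)))
  glue-regular {S₁ = S₁} {S₂} agree reg₁ reg₂ (inj₂ x) =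
    trans (degreeIn-inj₂ (glue S₁ S₂) x) (trans
      (splitDegree-cong G₂ v β (λ _ → refl) agree x)
      (trans (sym (degreeIn-≢ G₂ v β S₂ x)) (reg₂ (value x))))

  -- Both sides are connected by themselves, and the cut edge labelled `i` links them.
  glue-connected : ∀ {S₁ S₂} → D₁.ConnectedBy (S₁ ∘ value) → D₂.ConnectedBy (S₂ ∘ value) →
                   ∀ {i} → T (S₁ (e₁ i)) → G*.ConnectedBy (glue S₁ S₂)
  glue-connected {S₁} {S₂} conn₁ conn₂ {i} i∈S₁ = connect
    where
    H : G*.EdgeSet
    H = glue S₁ S₂
    bridge : G*.Adjacent H (inj₁ (L.neighbour α i)) (inj₂ (R.neighbour β i))
    bridge = inj₂ (inj₂ i) , i∈S₁ , inj₁ (refl , refl)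
    left : ∀ x y → Star (G*.Adjacent H) (inj₁ x) (inj₁ y)
    left x y = Star.gmap inj₁ (λ where
      (e , e∈ , inj₁ (p , q)) → inj₁ e , e∈ , inj₁ (cong inj₁ p , cong inj₁ q)
      (e , e∈ , inj₂ (p , q)) → inj₁ e , e∈ , inj₂ (cong inj₁ p , cong inj₁ q)) (conn₁ x y)
    right : ∀ x y → Star (G*.Adjacent H) (inj₂ x) (inj₂ y)
    right x y = Star.gmap inj₂ (λ where
      (e , e∈ , inj₁ (p , q)) → inj₂ (inj₁ e) , e∈ , inj₁ (cong inj₂ p , cong inj₂ q)
      (e , e∈ , inj₂ (p , q)) → inj₂ (inj₁ e) , e∈ , inj₂ (cong inj₂ p , cong inj₂ q)) (conn₂ x y)
    across : ∀ x y → Star (G*.Adjacent H) (inj₁ x) (inj₂ y)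
    across x y = left x _ ◅◅ bridge ◅ right _ y
    connect : G*.ConnectedBy H
    connect (inj₁ x) (inj₁ y) = left x y
    connect (inj₁ x) (inj₂ y) = across x y
    connect (inj₂ x) (inj₁ y) = Star.reverse (λ {a} {b} → adjacent-sym G {_} {a} {b}) (across y x)
    connect (inj₂ x) (inj₂ y) = right x y

  glue-Hamiltonian : ∀ {H₁ H₂} → (∀ i → H₁ (e₁ i) ≡ H₂ (e₂ i)) → G₁.HamiltonianCycle H₁ →
                     G₂.HamiltonianCycle H₂ → ∀ {i} → T (H₁ (e₁ i)) → G*.HamiltonianCycle (glue H₁ H₂)
  glue-Hamiltonian agree ham₁ ham₂ i∈ =
    glue-connected (cycle-vertex-connected G₁ u ham₁) (cycle-vertex-connected G₂ v ham₂) i∈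
    , glue-regular agree (proj₂ ham₁) (proj₂ ham₂)

  -- Perfect matchings of the star product and their extension to Hamiltonian cycles.

  -- Both factors see the same set of cut labels, so it can be counted in whichever factor is
  -- bipartite.
  count-cut : ∀ {M} → G*.PerfectMatching M → G₁.HasPerfectMatching → G₂.HasPerfectMatching →
              G₁.Bipartite ⊎ G₂.Bipartite → count (finite-Fin 3) (cut M) ≡ 1
  count-cut {M} pm pm₁ pm₂ (inj₁ bip) =
    bipartite-split G₁ u α bip pm₁ (sideˡ M) (cut M) λ x → trans (sym (degreeIn-inj₁ M x)) (pm (inj₁ x))
  count-cut {M} pm pm₁ pm₂ (inj₂ bip) =
    bipartite-split G₂ v β bip pm₂ (sideʳ M) (cut M) λ x → trans (sym (degreeIn-inj₂ M x)) (pm (inj₂ x))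

  -- A perfect matching of `G₁` uses some label at `u`; malleability supplies one of `G₂` with the
  -- same label at `v`, and the two can be glued.
  star-matching : G₁.HasPerfectMatching → ∀ {t} → G₂.Malleable t v → G*.HasPerfectMatching
  star-matching (M₁ , pm₁) mall
    with ∑ₛ-pick (finite-Fin 3) (M₁ ∘ e₁) (const 1) (trans (sym (degreeIn-centre G₁ u α M₁)) (pm₁ u))
  ... | i , i∈M₁ , _ with malleable-matching G₂ mall (incident-e₂ i)
  ... | M₂ , pm₂ , i∈M₂ = glue M₁ M₂ , glue-regular agree pm₁ pm₂
    where
    agree : ∀ l → M₁ (e₁ l) ≡ M₂ (e₂ l)
    agree = singletons-agree (finite-Fin 3)
      (trans (sym (degreeIn-centre G₁ u α M₁)) (pm₁ u))
      (trans (sym (degreeIn-centre G₂ v β M₂)) (pm₂ v)) i∈M₁ i∈M₂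

  -- A matching that meets the cut once contracts to perfect matchings of both
  -- factors.  The cycle through the first leaves u along a second edge, and
  -- malleability provides a cycle of G₂ leaving v along the partner of that edge.
  star-extend : G₁.PMH → G₂.Malleable 3 v → ∀ M → G*.PerfectMatching M →
                count (finite-Fin 3) (cut M) ≡ 1 → ∃[ H ] G*.HamiltonianCycle H × M G*.⊆ᴱ H
  star-extend (_ , extend₁) (_ , _ , _ , cycles₂) M pm one = result
    where
    M₁ : G₁.EdgeSet
    M₁ = extend G₁ u α (sideˡ M) (cut M)
    M₂ : G₂.EdgeSet
    M₂ = extend G₂ v β (sideʳ M) (cut M)
    pm₁ : G₁.PerfectMatching M₁
    pm₁ = extend-regular G₁ u α (λ x → trans (sym (degreeIn-inj₁ M x)) (pm (inj₁ x))) one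
    pm₂ : G₂.PerfectMatching M₂
    pm₂ = extend-regular G₂ v β (λ x → trans (sym (degreeIn-inj₂ M x)) (pm (inj₂ x))) one
    M-agree : ∀ l → M₂ (e₂ l) ≡ M₁ (e₁ l)
    M-agree l = trans (extend-to G₂ v β (sideʳ M) (cut M) l) (sym (extend-to G₁ u α (sideˡ M) (cut M) l))
    result : ∃[ H ] G*.HamiltonianCycle H × M G*.⊆ᴱ H
    result with extend₁ M₁ pm₁
    ... | H₁ , ham₁ , M₁⊆H₁
      with ∑ₛ-pick (finite-Fin 3) ((H₁ ∖ M₁) ∘ e₁) (const 1)
             (trans (sym (degreeIn-centre G₁ u α (H₁ ∖ M₁))) (matching-complement G₁ pm₁ (proj₂ ham₁) M₁⊆H₁ u))
    ... | j , j∈N₁ , _ with cycles₂ M₂ pm₂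
    -- The label `j` is missing from `M₁`, hence from `M₂`, which has the same labels; so the
    -- covering condition at `v` applies to `e₂ j`.
    ... | H₂s , hams₂ , cover with cover (e₂ j) (incident-e₂ j) (proj₂ (T-∖ H₁ M₁ j∈N₁) ∘ subst T (M-agree j))
    ... | k , j∈H₂ = glue H₁ H₂ , glue-Hamiltonian agree ham₁ ham₂ (proj₁ (T-∖ H₁ M₁ j∈N₁)) , contains
      where
      H₂ : G₂.EdgeSet
      H₂ = H₂s k
      ham₂ : G₂.HamiltonianCycle H₂
      ham₂ = proj₁ (hams₂ k)
      M₂⊆H₂ : M₂ G₂.⊆ᴱ H₂
      M₂⊆H₂ = proj₂ (hams₂ k)
      -- Outside the matchings, each cycle has a single edge at the deleted vertex, and in both
      -- cases its label is `j`.
      N-agree : ∀ l → (H₁ ∖ M₁) (e₁ l) ≡ (H₂ ∖ M₂) (e₂ l)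
      N-agree = singletons-agree (finite-Fin 3)
        (trans (sym (degreeIn-centre G₁ u α (H₁ ∖ M₁))) (matching-complement G₁ pm₁ (proj₂ ham₁) M₁⊆H₁ u))
        (trans (sym (degreeIn-centre G₂ v β (H₂ ∖ M₂))) (matching-complement G₂ pm₂ (proj₂ ham₂) M₂⊆H₂ v))
        j∈N₁ (∖-T H₂ M₂ j∈H₂ (proj₂ (T-∖ H₁ M₁ j∈N₁) ∘ subst T (M-agree j)))
      -- Each cycle is its matching together with the complementary one, and the labels of both
      -- parts agree.
      agree : ∀ l → H₁ (e₁ l) ≡ H₂ (e₂ l)
      agree l = begin
        H₁ (e₁ l)                          ≡⟨ ∨-∖ H₁ M₁ M₁⊆H₁ (e₁ l) ⟩
        M₁ (e₁ l) ∨ (H₁ ∖ M₁) (e₁ l)       ≡⟨ cong₂ _∨_ (sym (M-agree l)) (N-agree l) ⟩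
        M₂ (e₂ l) ∨ (H₂ ∖ M₂) (e₂ l)       ≡⟨ ∨-∖ H₂ M₂ M₂⊆H₂ (e₂ l) ⟨
        H₂ (e₂ l)                          ∎
      contains : M G*.⊆ᴱ glue H₁ H₂
      contains (inj₁ e)        = proj₁ (extend-⊆ G₁ u α (sideˡ M) (cut M) M₁⊆H₁) e
      contains (inj₂ (inj₁ e)) = proj₁ (extend-⊆ G₂ v β (sideʳ M) (cut M) M₂⊆H₂) e
      contains (inj₂ (inj₂ i)) = proj₂ (extend-⊆ G₁ u α (sideˡ M) (cut M) M₁⊆H₁) i

open Multigraph using (V; Connected; CubicOnTwoVertices; PMH; degree; Malleable; Ordering; Bipartite)

proposition3p4 : (G₁ G₂ : Multigraph) →
    Connected G₁ → Connected G₂ →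
    ¬ CubicOnTwoVertices G₁ → ¬ CubicOnTwoVertices G₂ →
    (u : V G₁) (v : V G₂) →
    PMH G₁ → degree G₁ u ≡ 3 →
    Malleable G₂ 3 v →
    (α : Ordering G₁ u) (β : Ordering G₂ v) →
    Bipartite G₁ ⊎ Bipartite G₂ →
    PMH (starProduct G₁ G₂ u v α β)
proposition3p4 G₁ G₂ _ _ _ _ u v pmh _ mall@(_ , _ , pm₂ , _) α β bip =
  star-matching G₁ G₂ u v α β (proj₁ pmh) mall ,
  λ M pm → star-extend G₁ G₂ u v α β pmh mall M pm (count-cut G₁ G₂ u v α β pm (proj₁ pmh) pm₂ bip)
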